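{- Let $q$ be an odd prime power, let $d\in\mathbb{N}$ be even with $d\mid(q-1)$ and $(q-1)/d$ odd. Let $h\in\mathbb{F}_q[x]$, $T(x)=x^{(q-1)/d}$ and $f(x)=x^2h(T(x))$. If $f$ is a permutation polynomial of $\mathbb{F}_q$, then $\delta_f\le 2d^2-\tfrac{3}{2}d$.
   Context: A polynomial $f\in\mathbb{F}_q[x]$ is a permutation polynomial of $\mathbb{F}_q$ if $c\mapsto f(c)$ is a bijection of $\mathbb{F}_q$. For $a\in\mathbb{F}_q^*$, $\Delta_{f,a}(x)=f(x+a)-f(x)$, and the differential uniformity is $\delta_f=\max_{a\in\mathbb{F}_q^*,\,c\in\mathbb{F}_q}|\{x\in\mathbb{F}_q:\Delta_{f,a}(x)=c\}|$. -}

module Defs where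

open import Algebra.Bundles using (CommutativeRing)
open import Data.Fin.Base using (Fin)
open import Data.Fin.Properties using (inj⇒≟)
open import Data.List.Base using (List; []; _∷_; map; filter; length; allFin; cartesianProductWith)
open import Data.List.Extrema.Nat using (max)
open import Data.Nat.Base as ℕ using (ℕ; zero; suc)
open import Data.Nat.Divisibility using () renaming (_∣_ to _∣ℕ_)
open import Data.Nat.Primality using (Prime)
open import Data.Product.Base using (∃; ∃₂; _×_)
open import Function.Bundles using (Inverse)
open import Function.Definitions using (Bijective)
open import Function.Properties.Inverse using (Inverse⇒Injection)
open import Level using (_⊔_) renaming (suc to lsuc)
open import Relation.Binary.Definitions using (Decidable)
open import Relation.Binary.PropositionalEquality using (_≡_; setoid)
open import Relation.Nullary.Decidable using (¬?)
open import Relation.Nullary.Negation using (¬_)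

Even : ℕ → Set
Even n = 2 ∣ℕ n

Odd : ℕ → Set
Odd n = ¬ Even n

IsPrimePower : ℕ → Set
IsPrimePower q = ∃₂ λ p k → Prime p × 1 ℕ.≤ k × q ≡ p ℕ.^ k

record FiniteField c ℓ (q : ℕ) : Set (lsuc (c ⊔ ℓ)) where
  field
    commutativeRing : CommutativeRing c ℓ

  open CommutativeRing commutativeRing public
    renaming (setoid to ≈-setoid)

  field
    1≉0         : ¬ (1# ≈ 0#)
    invertible  : ∀ x → ¬ (x ≈ 0#) → ∃ λ y → x * y ≈ 1#
    enumeration : Inverse ≈-setoid (setoid (Fin q))

  _≟_ : Decidable _≈_
  _≟_ = inj⇒≟ (Inverse⇒Injection enumeration)

  -- Each element of the field occurs exactly once, up to _≈_.
  elements : List Carrier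
  elements = map (Inverse.from enumeration) (allFin q)

  nonzeroElements : List Carrier
  nonzeroElements = filter (λ x → ¬? (x ≟ 0#)) elements

module Polynomials {c ℓ q} (F : FiniteField c ℓ q) where
  open FiniteField F

  -- Coefficients, constant term first.  Trailing zeros are allowed, so a
  -- polynomial has many representatives.
  Poly : Set c
  Poly = List Carrier

  infixl 6 _+ₚ_ _-ₚ_
  infixl 7 _*ₚ_
  infixr 8 _^ₚ_
  infixr 9 _∘ₚ_

  const : Carrier → Poly
  const a = a ∷ []

  X : Poly
  X = 0# ∷ 1# ∷ []

  _+ₚ_ : Poly → Poly → Poly
  []       +ₚ g        = g
  (a ∷ f)  +ₚ []       = a ∷ f
  (a ∷ f)  +ₚ (b ∷ g)  = (a + b) ∷ (f +ₚ g)

  _-ₚ_ : Poly → Poly → Poly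
  f -ₚ g = f +ₚ map (-_) g

  _*ₚ_ : Poly → Poly → Poly
  []       *ₚ g = []
  (a ∷ f)  *ₚ g = map (a *_) g +ₚ (0# ∷ (f *ₚ g))

  _^ₚ_ : Poly → ℕ → Poly
  f ^ₚ zero   = const 1#
  f ^ₚ suc n  = f *ₚ (f ^ₚ n)

  _∘ₚ_ : Poly → Poly → Poly
  []       ∘ₚ g = []
  (a ∷ f)  ∘ₚ g = const a +ₚ g *ₚ (f ∘ₚ g)

  eval : Poly → Carrier → Carrier
  eval []       x = 0#
  eval (a ∷ f)  x = a + x * eval f x

  IsPermutationPolynomial : Poly → Set (c ⊔ ℓ)
  IsPermutationPolynomial f = Bijective _≈_ _≈_ (eval f)

  Δ : Poly → Carrier → Poly
  Δ f a = f ∘ₚ (X +ₚ const a) -ₚ f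

  fibreSize : Poly → Carrier → ℕ
  fibreSize g y = length (filter (λ x → eval g x ≟ y) elements)

  differentialUniformity : Poly → ℕ
  differentialUniformity f =
    max 0 (cartesianProductWith (λ a y → fibreSize (Δ f a) y) nonzeroElements elements)

{-# OPTIONS --safe #-}

-- On the coset {T = ζ} the map f is h(ζ) x², and T(−x) = −T(x) since (q−1)/d is odd.
-- So the solutions of f(x+a) − f(x) = b with T(x) = ζ and T(x+a) = η satisfy the quadratic
-- A (x+a)² − B x² = b with A = h(η), B = h(ζ): at most two of them, and at most one if ζ = η.
-- Vieta's formulas determine T(b − A a²) and T(b + B a²) whenever there are two.  Hence if both
-- (ζ,−ζ) and (−ζ,ζ) have two solutions, then (ζ,ζ) and (−ζ,−ζ) have none, so these four pairs
-- together contribute at most 5 instead of 6.  With e = d/2 classes ± ζ this gives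
-- 5 e + 8 e (e−1) = 2 d² − 3d/2.

module Submission where

open import Defs
open import Algebra.Bundles using (CommutativeRing)
import Algebra.Properties.CommutativeMonoid.Sum as SumProperties
import Algebra.Properties.CommutativeSemiring.Exp as ExpProperties
import Algebra.Properties.Group as GroupProperties
import Algebra.Properties.Ring as RingProperties
import Algebra.Properties.Semiring.Mult as SemiringMultProperties
import Algebra.Solver.Ring as RingSolver
open import Algebra.Solver.Ring.AlmostCommutativeRing using (fromCommutativeRing; _-Raw-AlmostCommutative⟶_)
open import Data.Bool.Base using (true; false; if_then_else_)
open import Data.Fin.Base using (Fin; zero; suc; punchIn)
open import Data.Fin.Permutation using (Permutation′; permutation; _⟨$⟩ʳ_)
open import Data.Fin.Properties using (punchInᵢ≢i)
open import Data.Integer.Base as ℤ using (ℤ; +_; -[1+_]; _⊖_)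
import Data.Integer.Properties as ℤ
open import Data.Integer.Solver using (module +-*-Solver)
open import Data.List.Base using (List; []; _∷_; map; filter; length)
open import Data.List.Extrema.Nat using (max≤v⁺)
open import Data.List.Membership.Setoid.Properties using (∈-filter⁺; ∈-filter⁻)
open import Data.List.Relation.Unary.All as All using (All; []; _∷_)
import Data.List.Relation.Unary.All.Properties as All
open import Data.List.Relation.Unary.AllPairs using ([]; _∷_)
open import Data.List.Relation.Unary.Any as Any using (Any; here; there)
import Data.List.Relation.Unary.Any.Properties as Any
import Data.List.Relation.Unary.Unique.Propositional.Properties as Uniqueₚ
open import Data.List.Relation.Unary.Unique.Setoid using (Unique)
import Data.List.Relation.Unary.Unique.Setoid.Properties as Unique
open import Data.Maybe.Base as Maybe using ()
open import Data.Nat.Base as ℕ using (ℕ; zero; suc; NonZero; _∸_; z≤n; s≤s) renaming (_/_ to _/ℕ_)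
open import Data.Nat.DivMod using (m/n*n≡m)
open import Data.Nat.Divisibility using (divides) renaming (_∣_ to _∣ℕ_)
open import Data.Nat.ListAction using (sum)
import Data.Nat.Properties as ℕ
open import Data.Product.Base using (∃; ∃₂; _×_; _,_; proj₁; proj₂)
open import Data.Sum.Base using (_⊎_; inj₁; inj₂; [_,_]′)
open import Data.Vec.Base using (Vec; []; _∷_; replicate)
open import Function.Base using (_∘_; id)
open import Function.Bundles using (Inverse)
open import Level using (Level)
open import Relation.Binary.Bundles using (Setoid)
open import Relation.Binary.PropositionalEquality as ≡ using (_≡_; _≢_)
open import Relation.Nullary.Decidable using (¬?; Dec; yes; no; does; toSum; dec-true; dec-false; dec⇒maybe; decidable-stable; ¬¬-excluded-middle)
open import Relation.Nullary.Negation using (¬_; contradiction)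
open import Relation.Unary using (Pred; _∩_)

-- Ring solver with integer coefficients over a commutative ring.

module IntegerCoefficients {c ℓ} (R : CommutativeRing c ℓ) where
  open CommutativeRing R
  open RingProperties ring using (-‿distribˡ-*; -‿distribʳ-*; -0#≈0#; -‿involutive; -‿+-comm)
  open SemiringMultProperties semiring using (×-homo-+; ×1-homo-*) renaming (_×_ to _·_)
  open import Relation.Binary.Reasoning.Setoid setoid

  fromℤ : ℤ → Carrier
  fromℤ (+ n)    = n · 1#
  fromℤ -[1+ n ] = - (suc n · 1#)

  fromℤ-⊖ : ∀ m n → fromℤ (m ⊖ n) ≈ m · 1# - n · 1#
  fromℤ-⊖ m       zero    = sym (trans (+-congˡ -0#≈0#) (+-identityʳ _))
  fromℤ-⊖ zero    (suc n) = sym (+-identityˡ _)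
  fromℤ-⊖ (suc m) (suc n) = begin
    fromℤ (suc m ⊖ suc n)                ≡⟨ ≡.cong fromℤ (ℤ.[1+m]⊖[1+n]≡m⊖n m n) ⟩
    fromℤ (m ⊖ n)                        ≈⟨ fromℤ-⊖ m n ⟩
    M - N                                ≈⟨ +-identityˡ _ ⟨
    0# + (M - N)                         ≈⟨ +-congʳ (-‿inverseʳ 1#) ⟨
    (1# - 1#) + (M - N)                  ≈⟨ +-assoc _ _ _ ⟩
    1# + (- 1# + (M - N))                ≈⟨ +-congˡ (trans (sym (+-assoc _ _ _)) (trans (+-congʳ (+-comm _ _)) (+-assoc _ _ _))) ⟩
    1# + (M + (- 1# - N))                ≈⟨ +-assoc _ _ _ ⟨
    (1# + M) + (- 1# - N)                ≈⟨ +-congˡ (-‿+-comm 1# N) ⟩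
    (1# + M) - (1# + N)                  ∎
    where
    M = m · 1#
    N = n · 1#

  fromℤ-neg : ∀ i → fromℤ (ℤ.- i) ≈ - fromℤ i
  fromℤ-neg (+ zero)  = sym -0#≈0#
  fromℤ-neg (+ suc n) = refl
  fromℤ-neg -[1+ n ]  = sym (-‿involutive _)

  fromℤ-+ : ∀ i j → fromℤ (i ℤ.+ j) ≈ fromℤ i + fromℤ j
  fromℤ-+ (+ m)    (+ n)    = ×-homo-+ 1# m n
  fromℤ-+ (+ m)    -[1+ n ] = fromℤ-⊖ m (suc n)
  fromℤ-+ -[1+ m ] (+ n)    = trans (fromℤ-⊖ n (suc m)) (+-comm _ _)
  fromℤ-+ -[1+ m ] -[1+ n ] = begin
    - (suc (suc (m ℕ.+ n)) · 1#)         ≡⟨ ≡.cong (λ k → - (suc k · 1#)) (≡.sym (ℕ.+-suc m n)) ⟩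
    - ((suc m ℕ.+ suc n) · 1#)           ≈⟨ -‿cong (×-homo-+ 1# (suc m) (suc n)) ⟩
    - (suc m · 1# + suc n · 1#)          ≈⟨ -‿+-comm _ _ ⟨
    - (suc m · 1#) - (suc n · 1#)        ∎

  fromℤ-*⁺ : ∀ m n → fromℤ (+ m ℤ.* + n) ≈ fromℤ (+ m) * fromℤ (+ n)
  fromℤ-*⁺ m n = trans (reflexive (≡.cong fromℤ (≡.sym (ℤ.pos-* m n)))) (×1-homo-* m n)

  fromℤ-*ʳ : ∀ m j → fromℤ (+ m ℤ.* j) ≈ fromℤ (+ m) * fromℤ j
  fromℤ-*ʳ m (+ n)    = fromℤ-*⁺ m n
  fromℤ-*ʳ m -[1+ n ] = begin
    fromℤ (+ m ℤ.* -[1+ n ])             ≡⟨ ≡.cong fromℤ (ℤ.neg-distribʳ-* (+ m) (+ suc n)) ⟨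
    fromℤ (ℤ.- (+ m ℤ.* + suc n))        ≈⟨ fromℤ-neg (+ m ℤ.* + suc n) ⟩
    - fromℤ (+ m ℤ.* + suc n)            ≈⟨ -‿cong (fromℤ-*⁺ m (suc n)) ⟩
    - (m · 1# * suc n · 1#)              ≈⟨ -‿distribʳ-* _ _ ⟩
    m · 1# * - (suc n · 1#)              ∎

  fromℤ-* : ∀ i j → fromℤ (i ℤ.* j) ≈ fromℤ i * fromℤ j
  fromℤ-* (+ m)    j = fromℤ-*ʳ m j
  fromℤ-* -[1+ m ] j = begin
    fromℤ (-[1+ m ] ℤ.* j)               ≡⟨ ≡.cong fromℤ (ℤ.neg-distribˡ-* (+ suc m) j) ⟨
    fromℤ (ℤ.- (+ suc m ℤ.* j))          ≈⟨ fromℤ-neg (+ suc m ℤ.* j) ⟩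
    - fromℤ (+ suc m ℤ.* j)              ≈⟨ -‿cong (fromℤ-*ʳ (suc m) j) ⟩
    - (suc m · 1# * fromℤ j)             ≈⟨ -‿distribˡ-* _ _ ⟩
    - (suc m · 1#) * fromℤ j             ∎

  -- Taking coefficients in ℤ, where equality is decidable, lets the solver cancel terms although
  -- the ring itself is arbitrary.
  fromℤ-morphism : CommutativeRing.rawRing ℤ.+-*-commutativeRing -Raw-AlmostCommutative⟶ fromCommutativeRing R
  fromℤ-morphism = record
    { ⟦_⟧    = fromℤ
    ; +-homo = fromℤ-+
    ; *-homo = fromℤ-*
    ; -‿homo = fromℤ-neg
    ; 0-homo = refl
    ; 1-homo = +-identityʳ 1#
    }

  open RingSolver _ (fromCommutativeRing R) fromℤ-morphism
    (λ i j → Maybe.map (λ i≡j → reflexive (≡.cong fromℤ i≡j)) (dec⇒maybe (i ℤ.≟ j)))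
    public using (solve; _:+_; _:*_; _:-_; :-_; _:=_; con)


-- Parity, and upper bounds for the size of a predicate.

even⊎odd : ∀ n → Even n ⊎ ∃ λ k → n ≡ suc (k ℕ.* 2)
even⊎odd zero = inj₁ (divides 0 ≡.refl)
even⊎odd (suc n) with even⊎odd n
... | inj₁ (divides k n≡) = inj₂ (k , ≡.cong suc n≡)
... | inj₂ (k , n≡)       = inj₁ (divides (suc k) (≡.cong suc n≡))

sum-map-≤ : ∀ {a} {A : Set a} (w : A → ℕ) {n} → (∀ x → w x ℕ.≤ n) → ∀ xs → sum (map w xs) ℕ.≤ length xs ℕ.* n
sum-map-≤ w w≤n []       = z≤n
sum-map-≤ w w≤n (x ∷ xs) = ℕ.+-mono-≤ (w≤n x) (sum-map-≤ w w≤n xs)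

module Cardinality {c ℓ} (S : Setoid c ℓ) where
  open Setoid S renaming (Carrier to A)

  private variable
    p r s : Level
    P Q R : Pred A p
    X : Set s
    m n : ℕ

  -- Size is measured by repetition-free lists, so a bound makes sense for a predicate that is not
  -- known to be finite or decidable.
  AtMost : ℕ → Pred A p → Set _
  AtMost n P = ∀ {xs} → Unique S xs → All P xs → length xs ℕ.≤ n

  Two : Pred A p → Set _
  Two P = ∃₂ λ x y → P x × P y × x ≉ y

  atMost-⊆ : (∀ {x} → P x → Q x) → AtMost n Q → AtMost n P
  atMost-⊆ P⊆Q Q≤n xs! Pxs = Q≤n xs! (All.map P⊆Q Pxs)

  atMost-≤ : m ℕ.≤ n → AtMost m P → AtMost n P
  atMost-≤ m≤n P≤m xs! Pxs = ℕ.≤-trans (P≤m xs! Pxs) m≤n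

  -- The empty list satisfies every bound, so an element of `P` may be assumed; later it supplies
  -- representatives of cosets.
  atMost-inhabited : (∀ {x} → P x → AtMost n P) → AtMost n P
  atMost-inhabited h {[]}     _   _            = z≤n
  atMost-inhabited h {x ∷ xs} xs! Pxs@(px ∷ _) = h px xs! Pxs

  -- The goal is an inequality of naturals, hence stable under double negation, so excluded middle
  -- may be applied to `X`.
  atMost-dec : (Dec X → AtMost n P) → AtMost n P
  atMost-dec h xs! Pxs =
    decidable-stable (_ ℕ.≤? _) (λ ¬goal → ¬¬-excluded-middle (λ X? → ¬goal (h X? xs! Pxs)))

  atMost-0 : (∀ {x} → ¬ P x) → AtMost 0 P
  atMost-0 ¬P = atMost-inhabited (λ px → contradiction px ¬P)

  atMost-1 : ¬ Two P → AtMost 1 P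
  atMost-1 ¬two {[]}         _                  _             = z≤n
  atMost-1 ¬two {_ ∷ []}     _                  _             = s≤s z≤n
  atMost-1 ¬two {x ∷ y ∷ xs} ((x≉y ∷ _) ∷ _)    (px ∷ py ∷ _) = contradiction (x , y , px , py , x≉y) ¬two

  atMost-2 : (∀ {x y z} → P x → P y → P z → x ≉ y → x ≉ z → ¬ (y ≉ z)) → AtMost 2 P
  atMost-2 h {[]}             _ _ = z≤n
  atMost-2 h {_ ∷ []}         _ _ = s≤s z≤n
  atMost-2 h {_ ∷ _ ∷ []}     _ _ = s≤s (s≤s z≤n)
  atMost-2 h {x ∷ y ∷ z ∷ xs} ((x≉y ∷ x≉z ∷ _) ∷ (y≉z ∷ _) ∷ _) (px ∷ py ∷ pz ∷ _) =
    contradiction y≉z (h px py pz x≉y x≉z)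

  atMost-⊎ : (∀ {x} → P x → Q x ⊎ R x) → AtMost m Q → AtMost n R → AtMost (m ℕ.+ n) P
  atMost-⊎ {P = P} {Q = Q} {R = R} {m = m} {n = n} cover Q≤m R≤n xs! Pxs =
    let ys , zs , _ , (ys! , Qys) , (zs! , Rzs) , eq = split xs! Pxs
    in ≡.subst (ℕ._≤ m ℕ.+ n) (≡.sym eq) (ℕ.+-mono-≤ (Q≤m ys! Qys) (R≤n zs! Rzs))
    where
    -- The property of `N` says that both parts inherit whatever holds throughout `xs`; applied to
    -- "differs from the head", it keeps them repetition-free.
    split : ∀ {xs} → Unique S xs → All P xs → ∃₂ λ ys zs →
            (∀ {N : Pred A ℓ} → All N xs → All N ys × All N zs) ×
            (Unique S ys × All Q ys) × (Unique S zs × All R zs) ×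
            length xs ≡ length ys ℕ.+ length zs
    split [] [] = [] , [] , (λ _ → [] , []) , ([] , []) , ([] , []) , ≡.refl
    split (x∉xs ∷ xs!) (px ∷ Pxs) with split xs! Pxs | cover px
    ... | ys , zs , sub , (ys! , Qys) , (zs! , Rzs) , eq | inj₁ qx =
      _ ∷ ys , zs , (λ { (nx ∷ Nxs) → nx ∷ proj₁ (sub Nxs) , proj₂ (sub Nxs) }) ,
      (proj₁ (sub x∉xs) ∷ ys! , qx ∷ Qys) , (zs! , Rzs) , ≡.cong suc eq
    ... | ys , zs , sub , (ys! , Qys) , (zs! , Rzs) , eq | inj₂ rx =
      ys , _ ∷ zs , (λ { (nx ∷ Nxs) → proj₁ (sub Nxs) , nx ∷ proj₂ (sub Nxs) }) ,
      (ys! , Qys) , (proj₂ (sub x∉xs) ∷ zs! , rx ∷ Rzs) ,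
      ≡.trans (≡.cong suc eq) (≡.sym (ℕ.+-suc _ _))

  atMost-sum : ∀ {b} {B : Set b} (ks : List B) (_~_ : A → B → Set r) (w : B → ℕ) →
               (∀ {x} → P x → Any (x ~_) ks) →
               (∀ k → AtMost (w k) (P ∩ (_~ k))) →
               AtMost (sum (map w ks)) P
  atMost-sum []       _~_ w cover fibres = atMost-0 (λ px → contradiction (cover px) λ ())
  atMost-sum {P = P} (k ∷ ks) _~_ w cover fibres =
    atMost-⊎ {Q = P ∩ (_~ k)} {R = P ∩ (λ x → Any (x ~_) ks)}
      (λ px → [ (λ x~k → inj₁ (px , x~k)) , (λ x~ks → inj₂ (px , x~ks)) ]′ (Any.toSum (cover px)))
      (fibres k)
      (atMost-sum ks _~_ w proj₂ (λ k′ → atMost-⊆ (λ ((px , _) , x~k′) → px , x~k′) (fibres k′)))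

-- Arithmetic of finite fields.

module FiniteFieldProperties {c ℓ q} (F : FiniteField c ℓ q) where
  open FiniteField F hiding (zero)
  open RingProperties ring using (x∙y⁻¹≈ε⇒x≈y)
  open ExpProperties commutativeSemiring
  open IntegerCoefficients commutativeRing
  open SemiringMultProperties semiring using (×1-homo-*) renaming (_×_ to _·_)
  open Inverse enumeration using (to; from; to-cong; strictlyInverseˡ; strictlyInverseʳ)
  open import Relation.Binary.Reasoning.Setoid ≈-setoid
  module Sum = SumProperties +-commutativeMonoid
  module Product = SumProperties *-commutativeMonoid

  *-cancelˡ-≉0 : ∀ {x y z} → x ≉ 0# → x * y ≈ x * z → y ≈ z
  *-cancelˡ-≉0 {x} {y} {z} x≉0 xy≈xz with x⁻¹ , xx⁻¹≈1 ← invertible x x≉0 = begin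
    y               ≈⟨ *-identityˡ y ⟨
    1# * y          ≈⟨ *-congʳ (trans (*-comm _ _) xx⁻¹≈1) ⟨
    x⁻¹ * x * y     ≈⟨ *-assoc _ _ _ ⟩
    x⁻¹ * (x * y)   ≈⟨ *-congˡ xy≈xz ⟩
    x⁻¹ * (x * z)   ≈⟨ *-assoc _ _ _ ⟨
    x⁻¹ * x * z     ≈⟨ *-congʳ (trans (*-comm _ _) xx⁻¹≈1) ⟩
    1# * z          ≈⟨ *-identityˡ z ⟩
    z               ∎

  x*y≈0⇒y≈0 : ∀ {x y} → x ≉ 0# → x * y ≈ 0# → y ≈ 0#
  x*y≈0⇒y≈0 x≉0 xy≈0 = *-cancelˡ-≉0 x≉0 (trans xy≈0 (sym (zeroʳ _)))

  *-≉0 : ∀ {x y} → x ≉ 0# → y ≉ 0# → x * y ≉ 0#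
  *-≉0 x≉0 y≉0 xy≈0 = y≉0 (x*y≈0⇒y≈0 x≉0 xy≈0)

  ^-≉0 : ∀ {x} n → x ≉ 0# → x ^ n ≉ 0#
  ^-≉0 zero    x≉0 = 1≉0
  ^-≉0 (suc n) x≉0 = *-≉0 x≉0 (^-≉0 n x≉0)

  x-y≈0⇒x≈y : ∀ {x y} → x - y ≈ 0# → x ≈ y
  x-y≈0⇒x≈y = x∙y⁻¹≈ε⇒x≈y _ _

  x+y≈0⇒x≈-y : ∀ {x y} → x + y ≈ 0# → x ≈ - y
  x+y≈0⇒x≈-y {x} {y} = GroupProperties.inverseˡ-unique +-group x y

  x≉y⇒x-y≉0 : ∀ {x y} → x ≉ y → x - y ≉ 0#
  x≉y⇒x-y≉0 x≉y x-y≈0 = x≉y (x-y≈0⇒x≈y x-y≈0)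

  x*x≈y*y⇒x≈±y : ∀ {x y} → x * x ≈ y * y → x ≈ y ⊎ x ≈ - y
  x*x≈y*y⇒x≈±y {x} {y} xx≈yy with x ≟ y
  ... | yes x≈y = inj₁ x≈y
  ... | no  x≉y = inj₂ (x+y≈0⇒x≈-y (x*y≈0⇒y≈0 (x≉y⇒x-y≉0 x≉y) (begin
    (x - y) * (x + y)   ≈⟨ solve 2 (λ x y → (x :- y) :* (x :+ y) := x :* x :- y :* y) refl x y ⟩
    x * x - y * y       ≈⟨ +-congʳ xx≈yy ⟩
    y * y - y * y       ≈⟨ -‿inverseʳ _ ⟩
    0#                  ∎)))

  -- Moves a bijection of the field to the index set `Fin q`, over which finite sums and products
  -- are reindexed.
  bijection⇒permutation : (f g : Carrier → Carrier) →
    (∀ {x y} → x ≈ y → f x ≈ f y) → (∀ {x y} → x ≈ y → g x ≈ g y) →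
    (∀ x → f (g x) ≈ x) → (∀ x → g (f x) ≈ x) → Permutation′ q
  bijection⇒permutation f g f-cong g-cong f∘g g∘f = permutation
    (to ∘ f ∘ from) (to ∘ g ∘ from)
    (λ i → ≡.trans (to-cong (trans (f-cong (strictlyInverseʳ _)) (f∘g _))) (strictlyInverseˡ i))
    (λ i → ≡.trans (to-cong (trans (g-cong (strictlyInverseʳ _)) (g∘f _))) (strictlyInverseˡ i))

  -- Translation by `1#` permutes the field, so the sum of all elements is unchanged when q copies
  -- of `1#` are added to it.
  q·1≈0 : q · 1# ≈ 0#
  q·1≈0 = begin
    q · 1#                    ≈⟨ Sum.sum-replicate q ⟨
    Sum.sum {q} (λ _ → 1#)    ≈⟨ solve 2 (λ x s → x := (x :+ s) :- s) refl _ Σ ⟩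
    (Sum.sum {q} (λ _ → 1#) + Σ) - Σ  ≈⟨ +-congʳ (Sum.∑-distrib-+ {q} (λ _ → 1#) from) ⟨
    Sum.sum (λ i → 1# + from i) - Σ   ≈⟨ +-congʳ (Sum.sum-cong-≋ (λ i → strictlyInverseʳ (1# + from i))) ⟨
    Sum.sum (λ i → from (shift ⟨$⟩ʳ i)) - Σ ≈⟨ +-congʳ (Sum.sum-permute from shift) ⟨
    Σ - Σ                     ≈⟨ -‿inverseʳ Σ ⟩
    0#                        ∎
    where
    Σ = Sum.sum from
    shift = bijection⇒permutation (λ x → 1# + x) (λ x → - 1# + x) +-congˡ +-congˡ
      (λ x → trans (sym (+-assoc _ _ _)) (trans (+-congʳ (-‿inverseʳ 1#)) (+-identityˡ x)))
      (λ x → trans (sym (+-assoc _ _ _)) (trans (+-congʳ (-‿inverseˡ 1#)) (+-identityˡ x)))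

  -- For q = 2k + 1, the relation 1 + 1 = 0 would reduce q · 1 to 1, whereas q · 1 = 0.
  odd⇒1+1≉0 : Odd q → 1# + 1# ≉ 0#
  odd⇒1+1≉0 q-odd 1+1≈0 with even⊎odd q
  ... | inj₁ q-even    = q-odd q-even
  ... | inj₂ (k , q≡) = 1≉0 (begin
    1#                            ≈⟨ +-identityʳ 1# ⟨
    1# + 0#                       ≈⟨ +-congˡ (zeroʳ _) ⟨
    1# + (k · 1#) * 0#            ≈⟨ +-congˡ (*-congˡ (trans (+-congˡ (+-identityʳ 1#)) 1+1≈0)) ⟨
    1# + (k · 1#) * (2 · 1#)      ≈⟨ +-congˡ (×1-homo-* k 2) ⟨
    suc (k ℕ.* 2) · 1#            ≡⟨ ≡.cong (_· 1#) q≡ ⟨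
    q · 1#                        ≈⟨ q·1≈0 ⟩
    0#                            ∎)

  product-≉0 : ∀ {n} (t : Fin n → Carrier) → (∀ i → t i ≉ 0#) → Product.sum t ≉ 0#
  product-≉0 {zero}  t t≉0 = 1≉0
  product-≉0 {suc n} t t≉0 = *-≉0 (t≉0 zero) (product-≉0 (t ∘ suc) (t≉0 ∘ suc))

  product-allButOne : ∀ {n x} (t : Fin n → Carrier) i →
    t i ≈ 1# → (∀ j → j ≢ i → t j ≈ x) → Product.sum t ≈ x ^ (n ∸ 1)
  product-allButOne {suc n} {x} t i tᵢ≈1 t≈x = begin
    Product.sum t                                    ≈⟨ Product.sum-remove {i = i} t ⟩
    t i * Product.sum (λ j → t (punchIn i j))        ≈⟨ *-cong tᵢ≈1 (Product.sum-cong-≋ (λ j → t≈x (punchIn i j) (punchInᵢ≢i i j))) ⟩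
    1# * Product.sum {n} (λ _ → x)                   ≈⟨ *-identityˡ _ ⟩
    Product.sum {n} (λ _ → x)                        ≈⟨ Product.sum-replicate n ⟩
    x ^ n                                            ∎

  infixr 5 _orElse_

  -- Serves two purposes: with default `1#` it removes zero from a product over the whole field, and
  -- with the other of x and x + a as default it assigns a coset to a zero argument.
  _orElse_ : Carrier → Carrier → Carrier
  x orElse y = if does (x ≟ 0#) then y else x

  orElse-≈0 : ∀ {x y} → x ≈ 0# → x orElse y ≈ y
  orElse-≈0 {x} {y} x≈0 = reflexive (≡.cong (if_then y else x) (dec-true (x ≟ 0#) x≈0))

  orElse-≉0 : ∀ {x y} → x ≉ 0# → x orElse y ≈ x
  orElse-≉0 {x} {y} x≉0 = reflexive (≡.cong (if_then y else x) (dec-false (x ≟ 0#) x≉0))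

  orElse-nonzero : ∀ {x y} → (x ≈ 0# → y ≉ 0#) → x orElse y ≉ 0#
  orElse-nonzero {x} y≉0 ≈0 with toSum (x ≟ 0#)
  ... | inj₁ x≈0 = y≉0 x≈0 (trans (sym (orElse-≈0 x≈0)) ≈0)
  ... | inj₂ x≉0 = x≉0 (trans (sym (orElse-≉0 x≉0)) ≈0)

  -- Multiplication by x permutes the nonzero elements, so it preserves their product.
  x^[q-1]≈1 : ∀ {x} → x ≉ 0# → x ^ (q ∸ 1) ≈ 1#
  x^[q-1]≈1 {x} x≉0 with x⁻¹ , xx⁻¹≈1 ← invertible x x≉0 = *-cancelˡ-≉0 Π≉0 (begin
    Π * x ^ (q ∸ 1)                           ≈⟨ *-congˡ (product-allButOne κ (to 0#) (κ-≈0 (strictlyInverseʳ 0#)) (λ j j≢ → κ-≉0 (λ ≈0 → j≢ (≡.trans (≡.sym (strictlyInverseˡ j)) (to-cong ≈0))))) ⟨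
    Π * Product.sum κ                         ≈⟨ *-comm _ _ ⟩
    Product.sum κ * Π                         ≈⟨ Product.∑-distrib-+ κ (ν ∘ from) ⟨
    Product.sum (λ i → κ i * ν (from i))      ≈⟨ Product.sum-cong-≋ κν ⟨
    Product.sum (λ i → ν (from (scale ⟨$⟩ʳ i))) ≈⟨ Product.sum-permute (ν ∘ from) scale ⟨
    Π                                         ≈⟨ *-identityʳ Π ⟨
    Π * 1#                                    ∎)
    where
    ν : Carrier → Carrier
    ν y = y orElse 1#

    -- The factor by which `ν` changes when y is replaced by x y; it is 1 at y = 0, where `ν` is 1
    -- before and after.
    κ : Fin q → Carrier
    κ i = if does (from i ≟ 0#) then 1# else x

    Π = Product.sum (ν ∘ from)

    Π≉0 : Π ≉ 0#
    Π≉0 = product-≉0 (ν ∘ from) (λ _ → orElse-nonzero (λ _ → 1≉0))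

    κ-≈0 : ∀ {i} → from i ≈ 0# → κ i ≈ 1#
    κ-≈0 {i} ≈0 = reflexive (≡.cong (if_then 1# else x) (dec-true (from i ≟ 0#) ≈0))

    κ-≉0 : ∀ {i} → from i ≉ 0# → κ i ≈ x
    κ-≉0 {i} ≉0 = reflexive (≡.cong (if_then 1# else x) (dec-false (from i ≟ 0#) ≉0))

    scale = bijection⇒permutation (x *_) (x⁻¹ *_) *-congˡ *-congˡ
      (λ y → trans (sym (*-assoc _ _ _)) (trans (*-congʳ xx⁻¹≈1) (*-identityˡ y)))
      (λ y → trans (sym (*-assoc _ _ _)) (trans (*-congʳ (trans (*-comm _ _) xx⁻¹≈1)) (*-identityˡ y)))

    κν : ∀ i → ν (from (scale ⟨$⟩ʳ i)) ≈ κ i * ν (from i)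
    κν i = [ zero-case , nonzero-case ]′ (toSum (y ≟ 0#))
      where
      y = from i

      zero-case : y ≈ 0# → ν (from (to (x * y))) ≈ κ i * ν y
      zero-case y≈0 = begin
        ν (from (to (x * y)))   ≈⟨ orElse-≈0 (trans (strictlyInverseʳ _) (trans (*-congˡ y≈0) (zeroʳ x))) ⟩
        1#                      ≈⟨ *-identityˡ 1# ⟨
        1# * 1#                 ≈⟨ *-cong (κ-≈0 y≈0) (orElse-≈0 y≈0) ⟨
        κ i * ν y               ∎

      nonzero-case : y ≉ 0# → ν (from (to (x * y))) ≈ κ i * ν y
      nonzero-case y≉0 = begin
        ν (from (to (x * y)))   ≈⟨ orElse-≉0 (λ ≈0 → *-≉0 x≉0 y≉0 (trans (sym (strictlyInverseʳ _)) ≈0)) ⟩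
        from (to (x * y))       ≈⟨ strictlyInverseʳ _ ⟩
        x * y                   ≈⟨ *-cong (κ-≉0 y≉0) (orElse-≉0 y≉0) ⟨
        κ i * ν y               ∎

  elements-unique : Unique ≈-setoid elements
  elements-unique = Unique.map⁺ (≡.setoid (Fin q)) ≈-setoid
    (λ {i} {j} eq → ≡.trans (≡.sym (strictlyInverseˡ i)) (≡.trans (to-cong eq) (strictlyInverseˡ j)))
    (Uniqueₚ.allFin⁺ q)

  elements-complete : ∀ x → Any (x ≈_) elements
  elements-complete x = Any.map⁺ (Any.tabulate⁺ (to x) (sym (strictlyInverseʳ x)))

  -- Roots of polynomials and roots of unity.

  open Cardinality ≈-setoid

  -- The lower coefficients, constant term first; the leading coefficient 1 is implicit.
  evalMonic : ∀ {n} → Vec Carrier n → Carrier → Carrier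
  evalMonic []      x = 1#
  evalMonic (a ∷ p) x = a + x * evalMonic p x

  -- Synthetic division by x - r: the intermediate values of Horner's scheme at r are the
  -- coefficients of the quotient.
  quotient : ∀ {n} → Carrier → Vec Carrier (suc n) → Vec Carrier n
  quotient r (_ ∷ [])        = []
  quotient r (_ ∷ p@(_ ∷ _)) = evalMonic p r ∷ quotient r p

  quotient-correct : ∀ {n} (p : Vec Carrier (suc n)) r x →
    evalMonic p x ≈ evalMonic p r + (x - r) * evalMonic (quotient r p) x
  quotient-correct (a ∷ []) r x =
    solve 4 (λ a r x e → a :+ x :* e := (a :+ r :* e) :+ (x :- r) :* e) refl a r x 1#
  quotient-correct (a ∷ p@(_ ∷ _)) r x = begin
    a + x * evalMonic p x                            ≈⟨ +-congˡ (*-congˡ (quotient-correct p r x)) ⟩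
    a + x * (evalMonic p r + (x - r) * Q)            ≈⟨ solve 5 (λ a x r p q → a :+ x :* (p :+ (x :- r) :* q) := (a :+ r :* p) :+ (x :- r) :* (p :+ x :* q)) refl a x r (evalMonic p r) Q ⟩
    (a + r * evalMonic p r) + (x - r) * (evalMonic p r + x * Q) ∎
    where Q = evalMonic (quotient r p) x

  -- Once a root r is split off, every other root is a root of the quotient, because x - r is then
  -- nonzero; the degree drops by one.
  roots-atMost : ∀ {n} (p : Vec Carrier n) → AtMost n (λ x → evalMonic p x ≈ 0#)
  roots-atMost []        = atMost-0 1≉0
  roots-atMost (a ∷ p) {[]}     _            _          = z≤n
  roots-atMost (a ∷ p) {r ∷ xs} (r∉xs ∷ xs!) (pr ∷ pxs) =
    s≤s (roots-atMost (quotient r (a ∷ p)) xs! (All.zipWith (λ (r≉x , px) → quotient-root r≉x px) (r∉xs , pxs)))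
    where
    quotient-root : ∀ {x} → r ≉ x → evalMonic (a ∷ p) x ≈ 0# → evalMonic (quotient r (a ∷ p)) x ≈ 0#
    quotient-root {x} r≉x px = x*y≈0⇒y≈0 (x≉y⇒x-y≉0 (r≉x ∘ sym)) (begin
      (x - r) * Q                          ≈⟨ +-identityˡ _ ⟨
      0# + (x - r) * Q                     ≈⟨ +-congʳ pr ⟨
      evalMonic (a ∷ p) r + (x - r) * Q    ≈⟨ quotient-correct (a ∷ p) r x ⟨
      evalMonic (a ∷ p) x                  ≈⟨ px ⟩
      0#                                   ∎)
      where Q = evalMonic (quotient r (a ∷ p)) x

  rootsOfUnity-atMost : ∀ e .{{_ : NonZero e}} → AtMost e (λ x → x ^ e ≈ 1#)
  -- The vector lists the lower coefficients of the monic polynomial `x ^ suc e - 1#`.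
  rootsOfUnity-atMost (suc e) = atMost-⊆ root (roots-atMost (- 1# ∷ replicate e 0#))
    where
    monomial : ∀ n x → evalMonic (replicate n 0#) x ≈ x ^ n
    monomial zero    x = refl
    monomial (suc n) x = trans (+-identityˡ _) (*-congˡ (monomial n x))

    root : ∀ {x} → x ^ suc e ≈ 1# → - 1# + x * evalMonic (replicate e 0#) x ≈ 0#
    root {x} x^e≈1 = trans (+-congˡ (trans (*-congˡ (monomial e x)) x^e≈1)) (-‿inverseˡ 1#)

  -- With exponent (q - 1)/d this gives T(-x) = -T(x), the source of the contradictory sign in
  -- `twoPairs⇒diagonal-empty`.
  -x^odd : ∀ x k → (- x) ^ suc (k ℕ.* 2) ≈ - (x ^ suc (k ℕ.* 2))
  -x^odd x zero    = solve 2 (λ x e → (:- x) :* e := :- (x :* e)) refl x 1#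
  -x^odd x (suc k) = begin
    - x * (- x * (- x) ^ suc (k ℕ.* 2))   ≈⟨ *-congˡ (*-congˡ (-x^odd x k)) ⟩
    - x * (- x * - (x ^ suc (k ℕ.* 2)))   ≈⟨ solve 2 (λ x y → (:- x) :* ((:- x) :* (:- y)) := :- (x :* (x :* y))) refl x _ ⟩
    - (x * (x * x ^ suc (k ℕ.* 2)))       ∎

-- Evaluation of polynomial operations.

module Evaluation {c ℓ q} (F : FiniteField c ℓ q) where
  open FiniteField F hiding (zero)
  open Polynomials F
  open ExpProperties commutativeSemiring
  open IntegerCoefficients commutativeRing
  open import Relation.Binary.Reasoning.Setoid ≈-setoid

  eval-cong : ∀ f {x y} → x ≈ y → eval f x ≈ eval f y
  eval-cong []      x≈y = refl
  eval-cong (a ∷ f) x≈y = +-congˡ (*-cong x≈y (eval-cong f x≈y))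

  eval-const : ∀ a x → eval (const a) x ≈ a
  eval-const a x = trans (+-congˡ (zeroʳ x)) (+-identityʳ a)

  eval-X : ∀ x → eval X x ≈ x
  eval-X x = trans (+-identityˡ _) (trans (*-congˡ (eval-const 1# x)) (*-identityʳ x))

  eval-+ₚ : ∀ f g x → eval (f +ₚ g) x ≈ eval f x + eval g x
  eval-+ₚ []      g       x = sym (+-identityˡ _)
  eval-+ₚ (a ∷ f) []      x = sym (+-identityʳ _)
  eval-+ₚ (a ∷ f) (b ∷ g) x = begin
    (a + b) + x * eval (f +ₚ g) x              ≈⟨ +-congˡ (*-congˡ (eval-+ₚ f g x)) ⟩
    (a + b) + x * (eval f x + eval g x)        ≈⟨ solve 5 (λ a b x f g → (a :+ b) :+ x :* (f :+ g) := (a :+ x :* f) :+ (b :+ x :* g)) refl a b x _ _ ⟩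
    (a + x * eval f x) + (b + x * eval g x)    ∎

  eval-scale : ∀ b f x → eval (map (b *_) f) x ≈ b * eval f x
  eval-scale b []      x = sym (zeroʳ b)
  eval-scale b (a ∷ f) x = begin
    b * a + x * eval (map (b *_) f) x          ≈⟨ +-congˡ (*-congˡ (eval-scale b f x)) ⟩
    b * a + x * (b * eval f x)                 ≈⟨ solve 4 (λ b a x f → b :* a :+ x :* (b :* f) := b :* (a :+ x :* f)) refl b a x _ ⟩
    b * (a + x * eval f x)                     ∎

  eval-neg : ∀ f x → eval (map (-_) f) x ≈ - eval f x
  eval-neg []      x = solve 0 (con (+ 0) := :- con (+ 0)) refl
  eval-neg (a ∷ f) x = begin
    - a + x * eval (map (-_) f) x              ≈⟨ +-congˡ (*-congˡ (eval-neg f x)) ⟩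
    - a + x * - eval f x                       ≈⟨ solve 3 (λ a x f → :- a :+ x :* (:- f) := :- (a :+ x :* f)) refl a x _ ⟩
    - (a + x * eval f x)                       ∎

  eval-*ₚ : ∀ f g x → eval (f *ₚ g) x ≈ eval f x * eval g x
  eval-*ₚ []      g x = sym (zeroˡ _)
  eval-*ₚ (a ∷ f) g x = begin
    eval (map (a *_) g +ₚ (0# ∷ (f *ₚ g))) x              ≈⟨ eval-+ₚ (map (a *_) g) _ x ⟩
    eval (map (a *_) g) x + (0# + x * eval (f *ₚ g) x)    ≈⟨ +-cong (eval-scale a g x) (trans (+-identityˡ _) (*-congˡ (eval-*ₚ f g x))) ⟩
    a * eval g x + x * (eval f x * eval g x)              ≈⟨ solve 4 (λ a x f g → a :* g :+ x :* (f :* g) := (a :+ x :* f) :* g) refl a x _ _ ⟩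
    (a + x * eval f x) * eval g x                         ∎

  eval-^ₚ : ∀ f n x → eval (f ^ₚ n) x ≈ eval f x ^ n
  eval-^ₚ f zero    x = eval-const 1# x
  eval-^ₚ f (suc n) x = trans (eval-*ₚ f (f ^ₚ n) x) (*-congˡ (eval-^ₚ f n x))

  eval-∘ₚ : ∀ f g x → eval (f ∘ₚ g) x ≈ eval f (eval g x)
  eval-∘ₚ []      g x = refl
  eval-∘ₚ (a ∷ f) g x = begin
    eval (const a +ₚ g *ₚ (f ∘ₚ g)) x               ≈⟨ eval-+ₚ (const a) (g *ₚ (f ∘ₚ g)) x ⟩
    eval (const a) x + eval (g *ₚ (f ∘ₚ g)) x       ≈⟨ +-cong (eval-const a x) (trans (eval-*ₚ g _ x) (*-congˡ (eval-∘ₚ f g x))) ⟩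
    a + eval g x * eval f (eval g x)                ∎

  eval-Δ : ∀ f a x → eval (Δ f a) x ≈ eval f (x + a) - eval f x
  eval-Δ f a x = begin
    eval (Δ f a) x                                            ≈⟨ eval-+ₚ (f ∘ₚ (X +ₚ const a)) _ x ⟩
    eval (f ∘ₚ (X +ₚ const a)) x + eval (map (-_) f) x        ≈⟨ +-cong (eval-∘ₚ f (X +ₚ const a) x) (eval-neg f x) ⟩
    eval f (eval (X +ₚ const a) x) - eval f x                 ≈⟨ +-congʳ (eval-cong f (trans (eval-+ₚ X (const a) x) (+-cong (eval-X x) (eval-const a x)))) ⟩
    eval f (x + a) - eval f x                                 ∎

-- The difference equation for a fixed shift a and value b.

module _ {c ℓ q} (F : FiniteField c ℓ q) where
  open FiniteField F hiding (zero)
  open ExpProperties commutativeSemiring using (_^_; ^-congˡ; ^-distrib-*; ^-assocʳ; ^-congʳ)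

  -- Only values matter here: `φ` and `H` are the functions of f and h, while d = 2e and (q - 1)/d =
  -- 2k + 1.
  module Differential
    (1+1≉0 : 1# + 1# ≉ 0#)
    (k e : ℕ) .{{_ : NonZero e}}
    (q-1≡ : q ∸ 1 ≡ suc (k ℕ.* 2) ℕ.* (2 ℕ.* e))
    (H : Carrier → Carrier) (H-cong : ∀ {x y} → x ≈ y → H x ≈ H y)
    (φ : Carrier → Carrier) (φ≈ : ∀ x → φ x ≈ (x * x) * H (x ^ suc (k ℕ.* 2)))
    (φ-injective : ∀ {x y} → φ x ≈ φ y → x ≈ y)
    (a : Carrier) (a≉0 : a ≉ 0#) (b : Carrier)
    where

    open IntegerCoefficients commutativeRing
    open FiniteFieldProperties F
    open Cardinality ≈-setoid
    open import Relation.Binary.Reasoning.Setoid ≈-setoid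

    m : ℕ
    m = suc (k ℕ.* 2)

    T : Carrier → Carrier
    T x = x ^ m

    T-≉0 : ∀ {x} → x ≉ 0# → T x ≉ 0#
    T-≉0 = ^-≉0 m

    -- The exponents multiply to q - 1, so Fermat applies. Hence the squares of classes lie among
    -- the e-th roots of unity.
    T²-root : ∀ {x} → x ≉ 0# → (T x * T x) ^ e ≈ 1#
    T²-root {x} x≉0 = begin
      (T x * T x) ^ e      ≈⟨ ^-congˡ e (*-congˡ (*-identityʳ (T x))) ⟨
      (T x ^ 2) ^ e        ≈⟨ ^-assocʳ (T x) 2 e ⟩
      T x ^ (2 ℕ.* e)      ≈⟨ ^-assocʳ x m (2 ℕ.* e) ⟩
      x ^ (m ℕ.* (2 ℕ.* e)) ≈⟨ ^-congʳ x q-1≡ ⟨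
      x ^ (q ∸ 1)          ≈⟨ x^[q-1]≈1 x≉0 ⟩
      1#                   ∎

    -- Otherwise φ(x) = 0 = φ(0), against injectivity.
    H∘T-≉0 : ∀ {x} → x ≉ 0# → H (T x) ≉ 0#
    H∘T-≉0 {x} x≉0 HTx≈0 = x≉0 (φ-injective (begin
      φ x                          ≈⟨ φ≈ x ⟩
      (x * x) * H (T x)            ≈⟨ *-congˡ HTx≈0 ⟩
      (x * x) * 0#                 ≈⟨ zeroʳ _ ⟩
      0#                           ≈⟨ zeroˡ _ ⟨
      0# * H (T 0#)                ≈⟨ *-congʳ (zeroˡ 0#) ⟨
      (0# * 0#) * H (T 0#)         ≈⟨ φ≈ 0# ⟨
      φ 0#                         ∎))

    x+x≉0 : ∀ {x} → x ≉ 0# → x + x ≉ 0#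
    x+x≉0 {x} x≉0 x+x≈0 = *-≉0 1+1≉0 x≉0 (trans (distribʳ x 1# 1#) (trans (+-cong (*-identityˡ x) (*-identityˡ x)) x+x≈0))

    x≉-x : ∀ {x} → x ≉ 0# → x ≉ - x
    x≉-x {x} x≉0 x≈-x = x+x≉0 x≉0 (trans (+-congˡ x≈-x) (-‿inverseʳ x))

    -- The classes of x and x + a.  A zero argument, which lies in no coset, is
    -- given the class of the other one; this puts x = 0 and x = - a on the diagonal.

    u v : Carrier → Carrier
    u x = x orElse (x + a)
    v x = (x + a) orElse x

    x≈0⇒x+a≉0 : ∀ {x} → x ≈ 0# → x + a ≉ 0#
    x≈0⇒x+a≉0 x≈0 x+a≈0 = a≉0 (trans (sym (+-identityˡ a)) (trans (+-congʳ (sym x≈0)) x+a≈0))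

    u-≉0 : ∀ x → u x ≉ 0#
    u-≉0 x = orElse-nonzero x≈0⇒x+a≉0

    v-≉0 : ∀ x → v x ≉ 0#
    v-≉0 x = orElse-nonzero (λ x+a≈0 x≈0 → x≈0⇒x+a≉0 x≈0 x+a≈0)

    -- At x = 0 both sides vanish through the factor x², so the class given to a zero argument does
    -- not disturb the quadratic equation.
    square-orElse : ∀ x y → φ x ≈ H (T (x orElse y)) * (x * x)
    square-orElse x y with toSum (x ≟ 0#)
    ... | inj₁ x≈0 = begin
      φ x                               ≈⟨ φ≈ x ⟩
      (x * x) * H (T x)                 ≈⟨ *-congʳ xx≈0 ⟩
      0# * H (T x)                      ≈⟨ zeroˡ _ ⟩
      0#                                ≈⟨ zeroʳ _ ⟨
      H (T (x orElse y)) * 0#           ≈⟨ *-congˡ xx≈0 ⟨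
      H (T (x orElse y)) * (x * x)      ∎
      where xx≈0 = trans (*-congˡ x≈0) (zeroʳ x)
    ... | inj₂ x≉0 = trans (φ≈ x) (trans (*-comm _ _) (*-congʳ (H-cong (^-congˡ m (sym (orElse-≉0 x≉0))))))

    -- Solutions sorted by the classes of x and x + a.

    Solution : Pred Carrier ℓ
    Solution x = φ (x + a) - φ x ≈ b

    Class : Carrier → Carrier → Pred Carrier ℓ
    Class ζ η x = Solution x × T (u x) ≈ ζ × T (v x) ≈ η

    class-quadratic : ∀ {ζ η x} → Class ζ η x → H η * ((x + a) * (x + a)) - H ζ * (x * x) ≈ b
    class-quadratic {ζ} {η} {x} (sol , ζ≈ , η≈) = begin
      H η * ((x + a) * (x + a)) - H ζ * (x * x)                  ≈⟨ +-cong (*-congʳ (H-cong η≈)) (-‿cong (*-congʳ (H-cong ζ≈))) ⟨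
      H (T (v x)) * ((x + a) * (x + a)) - H (T (u x)) * (x * x)  ≈⟨ +-cong (square-orElse (x + a) x) (-‿cong (square-orElse x (x + a))) ⟨
      φ (x + a) - φ x                                            ≈⟨ sol ⟩
      b                                                          ∎

    class-H≉0 : ∀ {ζ η x} → Class ζ η x → H η ≉ 0#
    class-H≉0 {x = x} (_ , _ , η≈) Hη≈0 = H∘T-≉0 (v-≉0 x) (trans (H-cong η≈) Hη≈0)

    -- At x = 0 both `u x` and `v x` equal x + a, which would force ζ = η.
    class-u : ∀ {ζ η x} → ζ ≉ η → Class ζ η x → x ≉ 0#
    class-u {x = x} ζ≉η (_ , ζ≈ , η≈) x≈0 = ζ≉η (trans (sym ζ≈) (trans (^-congˡ m u≈v) η≈))
      where u≈v = trans (orElse-≈0 x≈0) (sym (orElse-≉0 (x≈0⇒x+a≉0 x≈0)))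

    class-v : ∀ {ζ η x} → ζ ≉ η → Class ζ η x → x + a ≉ 0#
    class-v {x = x} ζ≉η (_ , ζ≈ , η≈) x+a≈0 = ζ≉η (trans (sym ζ≈) (trans (^-congˡ m u≈v) η≈))
      where u≈v = trans (orElse-≉0 (λ x≈0 → x≈0⇒x+a≉0 x≈0 x+a≈0)) (sym (orElse-≈0 x+a≈0))

    -- Vieta's formulas for A (t + a)² - B t² = b with distinct roots x and y. `S≈0` is the relation
    -- for the sum; `product-u` and `product-v` are those for the product in the variables t and t +
    -- a.
    module Pair {ζ η x y} (x∈ : Class ζ η x) (y∈ : Class ζ η y) (x≉y : x ≉ y) where
      A B S : Carrier
      A = H η
      B = H ζ
      S = (A - B) * (x + y) + (a + a) * A

      S≈0 : S ≈ 0#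
      S≈0 = x*y≈0⇒y≈0 (x≉y⇒x-y≉0 x≉y) (begin
        (x - y) * S
          ≈⟨ solve 5 (λ A B a x y → (x :- y) :* ((A :- B) :* (x :+ y) :+ (a :+ a) :* A)
               := (A :* ((x :+ a) :* (x :+ a)) :- B :* (x :* x)) :- (A :* ((y :+ a) :* (y :+ a)) :- B :* (y :* y)))
             refl A B a x y ⟩
        (A * ((x + a) * (x + a)) - B * (x * x)) - (A * ((y + a) * (y + a)) - B * (y * y))
          ≈⟨ +-cong (class-quadratic x∈) (-‿cong (class-quadratic y∈)) ⟩
        b - b
          ≈⟨ -‿inverseʳ b ⟩
        0# ∎)

      -- For A = B the equation is linear: `S` becomes 2aA, which is nonzero in odd characteristic.
      A-B≉0 : A - B ≉ 0#
      A-B≉0 A-B≈0 = *-≉0 (x+x≉0 a≉0) (class-H≉0 x∈) (begin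
        (a + a) * A                        ≈⟨ +-identityˡ _ ⟨
        0# + (a + a) * A                   ≈⟨ +-congʳ (trans (*-congʳ A-B≈0) (zeroˡ _)) ⟨
        S                                  ≈⟨ S≈0 ⟩
        0#                                 ∎)

      product-u : b - A * (a * a) ≈ - ((A - B) * (x * y))
      product-u = begin
        b - A * (a * a)
          ≈⟨ +-congʳ (class-quadratic x∈) ⟨
        (A * ((x + a) * (x + a)) - B * (x * x)) - A * (a * a)
          ≈⟨ solve 5 (λ A B a x y → (A :* ((x :+ a) :* (x :+ a)) :- B :* (x :* x)) :- A :* (a :* a)
               := x :* ((A :- B) :* (x :+ y) :+ (a :+ a) :* A) :- (A :- B) :* (x :* y)) refl A B a x y ⟩
        x * S - (A - B) * (x * y)
          ≈⟨ +-congʳ (trans (*-congˡ S≈0) (zeroʳ x)) ⟩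
        0# - (A - B) * (x * y)
          ≈⟨ +-identityˡ _ ⟩
        - ((A - B) * (x * y)) ∎

      product-v : b + B * (a * a) ≈ - ((A - B) * ((x + a) * (y + a)))
      product-v = begin
        b + B * (a * a)
          ≈⟨ +-congʳ (class-quadratic x∈) ⟨
        (A * ((x + a) * (x + a)) - B * (x * x)) + B * (a * a)
          ≈⟨ solve 5 (λ A B a x y → (A :* ((x :+ a) :* (x :+ a)) :- B :* (x :* x)) :+ B :* (a :* a)
               := (x :+ a) :* ((A :- B) :* (x :+ y) :+ (a :+ a) :* A) :- (A :- B) :* ((x :+ a) :* (y :+ a))) refl A B a x y ⟩
        (x + a) * S - (A - B) * ((x + a) * (y + a))
          ≈⟨ +-congʳ (trans (*-congˡ S≈0) (zeroʳ _)) ⟩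
        0# - (A - B) * ((x + a) * (y + a))
          ≈⟨ +-identityˡ _ ⟩
        - ((A - B) * ((x + a) * (y + a))) ∎

    -- Subtracting the sum relations of the pairs (x, y) and (x, z) leaves (A - B)(y - z) = 0.
    class-atMost-2 : ∀ ζ η → AtMost 2 (Class ζ η)
    class-atMost-2 ζ η = atMost-2 λ {x} {y} {z} x∈ y∈ z∈ x≉y x≉z y≉z →
      let module XY = Pair x∈ y∈ x≉y
          module XZ = Pair x∈ z∈ x≉z
      in *-≉0 XY.A-B≉0 (x≉y⇒x-y≉0 y≉z) (begin
        (XY.A - XY.B) * (y - z)
          ≈⟨ solve 6 (λ A B a x y z → (A :- B) :* (y :- z)
               := ((A :- B) :* (x :+ y) :+ (a :+ a) :* A) :- ((A :- B) :* (x :+ z) :+ (a :+ a) :* A)) refl XY.A XY.B a x y z ⟩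
        XY.S - XZ.S                   ≈⟨ +-cong XY.S≈0 (-‿cong XZ.S≈0) ⟩
        0# - 0#                       ≈⟨ -‿inverseʳ 0# ⟩
        0#                            ∎)

    -- Here A = B, so a second solution would contradict `A-B≉0`.
    diagonal-atMost-1 : ∀ ζ → AtMost 1 (Class ζ ζ)
    diagonal-atMost-1 ζ = atMost-1 λ (x , y , x∈ , y∈ , x≉y) → Pair.A-B≉0 x∈ y∈ x≉y (-‿inverseʳ (H ζ))

    -- A diagonal element x satisfies  g x = b − A a²  and  g (x + a) = b + A a²  with g = 2 a A,
    -- and by Vieta these are  −(A − B) x₁x₂  and  (A − B) y₁y₂  for the two pairs of roots.
    -- Comparing the classes of both sides gives  η ζ² = − η ζ².
    twoPairs⇒diagonal-empty : ∀ {ζ η} → ζ ≉ η → Two (Class ζ η) → Two (Class η ζ) → ∀ {x} → ¬ Class η η x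
    twoPairs⇒diagonal-empty {ζ} {η} ζ≉η (x₁ , x₂ , x₁∈ , x₂∈ , x₁≉x₂) (w₁ , w₂ , w₁∈ , w₂∈ , w₁≉w₂) {x} x∈ =
      x≉-x Tprod≉0 (begin
        T (x * (y₁ * y₂))                ≈⟨ ^-congˡ m xyy≈ ⟩
        T (- ((x + a) * (x₁ * x₂)))      ≈⟨ -x^odd _ k ⟩
        - T ((x + a) * (x₁ * x₂))        ≈⟨ -‿cong (T-product (x + a) x₁ x₂) ⟩
        - (T (x + a) * (T x₁ * T x₂))    ≈⟨ -‿cong (*-cong Tv≈ (*-cong (T-u x₁∈) (T-u x₂∈))) ⟩
        - (η * (ζ * ζ))                  ≈⟨ -‿cong (*-cong Tu≈ (*-cong (T-v w₁∈) (T-v w₂∈))) ⟨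
        - (T x * (T y₁ * T y₂))          ≈⟨ -‿cong (T-product x y₁ y₂) ⟨
        - T (x * (y₁ * y₂))              ∎)
      where
      module X = Pair x₁∈ x₂∈ x₁≉x₂
      module W = Pair w₁∈ w₂∈ w₁≉w₂
      A B g y₁ y₂ : Carrier
      A = H η
      B = H ζ
      g = (a + a) * A
      y₁ = w₁ + a
      y₂ = w₂ + a

      η≉ζ : η ≉ ζ
      η≉ζ = ζ≉η ∘ sym

      T-product : ∀ x y z → T (x * (y * z)) ≈ T x * (T y * T z)
      T-product x y z = trans (^-distrib-* x (y * z) m) (*-congˡ (^-distrib-* y z m))

      T-u : ∀ {x} → Class ζ η x → T x ≈ ζ
      T-u x∈@(_ , ζ≈ , _) = trans (^-congˡ m (sym (orElse-≉0 (class-u ζ≉η x∈)))) ζ≈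

      T-v : ∀ {x} → Class η ζ x → T (x + a) ≈ ζ
      T-v x∈@(_ , _ , ζ≈) = trans (^-congˡ m (sym (orElse-≉0 (class-v η≉ζ x∈)))) ζ≈

      gx≈ : g * x ≈ - ((A - B) * (x₁ * x₂))
      gx≈ = begin
        g * x ≈⟨ solve 3 (λ A a x → ((a :+ a) :* A) :* x := (A :* ((x :+ a) :* (x :+ a)) :- A :* (x :* x)) :- A :* (a :* a)) refl A a x ⟩
        (A * ((x + a) * (x + a)) - A * (x * x)) - A * (a * a) ≈⟨ +-congʳ (class-quadratic x∈) ⟩
        b - A * (a * a) ≈⟨ X.product-u ⟩
        - ((A - B) * (x₁ * x₂)) ∎

      g[x+a]≈ : g * (x + a) ≈ (A - B) * (y₁ * y₂)
      g[x+a]≈ = begin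
        g * (x + a) ≈⟨ solve 3 (λ A a x → ((a :+ a) :* A) :* (x :+ a) := (A :* ((x :+ a) :* (x :+ a)) :- A :* (x :* x)) :+ A :* (a :* a)) refl A a x ⟩
        (A * ((x + a) * (x + a)) - A * (x * x)) + A * (a * a) ≈⟨ +-congʳ (class-quadratic x∈) ⟩
        -- The pair w has ζ and η interchanged, so its coefficients are B and A in this order; the
        -- next line restores the sign.
        b + A * (a * a) ≈⟨ W.product-v ⟩
        - ((B - A) * (y₁ * y₂)) ≈⟨ solve 3 (λ A B y → :- ((B :- A) :* y) := (A :- B) :* y) refl A B (y₁ * y₂) ⟩
        (A - B) * (y₁ * y₂) ∎

      g≉0 : g ≉ 0#
      g≉0 = *-≉0 (x+x≉0 a≉0) (class-H≉0 x∈)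

      -- Multiplied by g (A - B), both sides become (g x)(g (x + a)).
      xyy≈ : x * (y₁ * y₂) ≈ - ((x + a) * (x₁ * x₂))
      xyy≈ = *-cancelˡ-≉0 (*-≉0 g≉0 X.A-B≉0) (begin
        (g * (A - B)) * (x * (y₁ * y₂))             ≈⟨ solve 4 (λ g D x y → (g :* D) :* (x :* y) := (g :* x) :* (D :* y)) refl g (A - B) x (y₁ * y₂) ⟩
        (g * x) * ((A - B) * (y₁ * y₂))             ≈⟨ *-cong gx≈ (sym g[x+a]≈) ⟩
        - ((A - B) * (x₁ * x₂)) * (g * (x + a))     ≈⟨ solve 4 (λ g D z x → (:- (D :* x)) :* (g :* z) := (g :* D) :* (:- (z :* x))) refl g (A - B) (x + a) (x₁ * x₂) ⟩
        (g * (A - B)) * - ((x + a) * (x₁ * x₂))     ∎)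

      y₁y₂≉0 : y₁ * y₂ ≉ 0#
      y₁y₂≉0 = *-≉0 (class-v η≉ζ w₁∈) (class-v η≉ζ w₂∈)

      -‿≈0 : ∀ {z} → - z ≈ 0# → z ≈ 0#
      -‿≈0 {z} -z≈0 = trans (sym (+-identityʳ z)) (trans (+-congˡ (sym -z≈0)) (-‿inverseʳ z))

      -- Off-diagonal roots are nonzero, so neither is their product; thus the default of `orElse`
      -- does not intervene at x and T x is its class.
      x≉0 : x ≉ 0#
      x≉0 x≈0 = *-≉0 X.A-B≉0 (*-≉0 (class-u ζ≉η x₁∈) (class-u ζ≉η x₂∈))
        (-‿≈0 (trans (sym gx≈) (trans (*-congˡ x≈0) (zeroʳ g))))

      x+a≉0 : x + a ≉ 0#
      x+a≉0 x+a≈0 = *-≉0 X.A-B≉0 y₁y₂≉0 (trans (sym g[x+a]≈) (trans (*-congˡ x+a≈0) (zeroʳ g)))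

      Tu≈ : T x ≈ η
      Tu≈ = trans (^-congˡ m (sym (orElse-≉0 x≉0))) (proj₁ (proj₂ x∈))

      Tv≈ : T (x + a) ≈ η
      Tv≈ = trans (^-congˡ m (sym (orElse-≉0 x+a≉0))) (proj₂ (proj₂ x∈))

      Tprod≉0 : T (x * (y₁ * y₂)) ≉ 0#
      Tprod≉0 = T-≉0 (*-≉0 x≉0 y₁y₂≉0)

    -- Squaring identifies the classes ± ζ, so only e = d / 2 squares occur.
    Block : Carrier → Carrier → Pred Carrier ℓ
    Block ξ ξ′ x = (Solution x × T (u x) * T (u x) ≈ ξ) × T (v x) * T (v x) ≈ ξ′

    block-cover : ∀ {ξ ξ′ ζ η} → ζ * ζ ≈ ξ → η * η ≈ ξ′ → ∀ {x} → Block ξ ξ′ x →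
      (Class ζ η x ⊎ Class ζ (- η) x) ⊎ (Class (- ζ) η x ⊎ Class (- ζ) (- η) x)
    block-cover ζζ≈ ηη≈ ((sol , u≈) , v≈)
      with x*x≈y*y⇒x≈±y (trans u≈ (sym ζζ≈)) | x*x≈y*y⇒x≈±y (trans v≈ (sym ηη≈))
    ... | inj₁ u≈ζ  | inj₁ v≈η  = inj₁ (inj₁ (sol , u≈ζ , v≈η))
    ... | inj₁ u≈ζ  | inj₂ v≈-η = inj₁ (inj₂ (sol , u≈ζ , v≈-η))
    ... | inj₂ u≈-ζ | inj₁ v≈η  = inj₂ (inj₁ (sol , u≈-ζ , v≈η))
    ... | inj₂ u≈-ζ | inj₂ v≈-η = inj₂ (inj₂ (sol , u≈-ζ , v≈-η))

    block-atMost : ∀ {ξ ξ′ ζ η} → ζ * ζ ≈ ξ → η * η ≈ ξ′ → ∀ {i j k l} →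
      AtMost i (Class ζ η) → AtMost j (Class ζ (- η)) →
      AtMost k (Class (- ζ) η) → AtMost l (Class (- ζ) (- η)) →
      AtMost ((i ℕ.+ j) ℕ.+ (k ℕ.+ l)) (Block ξ ξ′)
    block-atMost ζζ≈ ηη≈ c₁ c₂ c₃ c₄ =
      atMost-⊎ (block-cover ζζ≈ ηη≈) (atMost-⊎ id c₁ c₂) (atMost-⊎ id c₃ c₄)

    -- An inhabitant provides square roots of ξ and ξ′; the block then splits into four classes with
    -- at most two solutions each.
    block-atMost-8 : ∀ ξ ξ′ → AtMost 8 (Block ξ ξ′)
    block-atMost-8 ξ ξ′ = atMost-inhabited λ ((_ , u≈) , v≈) →
      block-atMost u≈ v≈ (class-atMost-2 _ _) (class-atMost-2 _ _) (class-atMost-2 _ _) (class-atMost-2 _ _)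

    -- If one of the classes (ζ, -ζ), (-ζ, ζ) lacks two solutions, the four classes give at most 1 +
    -- 1 + 2 + 1. If both have two, the diagonal classes are empty and 2 + 2 remains.
    diagonalBlock-atMost-5 : ∀ {ξ ξ′} → ξ ≈ ξ′ → AtMost 5 (Block ξ ξ′)
    diagonalBlock-atMost-5 {ξ} {ξ′} ξ≈ξ′ = atMost-inhabited λ {x} ((_ , u≈) , _) →
      bound (T (u x)) (T-≉0 (u-≉0 x)) u≈ (trans u≈ ξ≈ξ′)
      where
      bound : ∀ ζ → ζ ≉ 0# → ζ * ζ ≈ ξ → ζ * ζ ≈ ξ′ → AtMost 5 (Block ξ ξ′)
      bound ζ ζ≉0 ζζ≈ξ ζζ≈ξ′ = atMost-dec λ two₁? → atMost-dec λ two₂? → cases two₁? two₂?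
        where
        cases : Dec (Two (Class ζ (- ζ))) → Dec (Two (Class (- ζ) ζ)) → AtMost 5 (Block ξ ξ′)
        -- The lemma is symmetric in the two off-diagonal classes: using them in either order
        -- empties (ζ, ζ) and (-ζ, -ζ).
        cases (yes two₁) (yes two₂) = atMost-≤ (ℕ.n≤1+n 4) (block-atMost ζζ≈ξ ζζ≈ξ′
          (atMost-0 (twoPairs⇒diagonal-empty (x≉-x ζ≉0 ∘ sym) two₂ two₁)) (class-atMost-2 _ _)
          (class-atMost-2 _ _) (atMost-0 (twoPairs⇒diagonal-empty (x≉-x ζ≉0) two₁ two₂)))
        cases (no ¬two₁) _          = block-atMost ζζ≈ξ ζζ≈ξ′
          (diagonal-atMost-1 _) (atMost-1 ¬two₁) (class-atMost-2 _ _) (diagonal-atMost-1 _)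
        cases (yes _)    (no ¬two₂) = block-atMost ζζ≈ξ ζζ≈ξ′
          (diagonal-atMost-1 _) (class-atMost-2 _ _) (atMost-1 ¬two₂) (diagonal-atMost-1 _)

    -- Summation over all blocks.

    roots : List Carrier
    roots = filter (λ ξ → (ξ ^ e) ≟ 1#) elements

    N : ℕ
    N = length roots

    N≤e : N ℕ.≤ e
    N≤e = rootsOfUnity-atMost e (Unique.filter⁺ ≈-setoid (λ ξ → (ξ ^ e) ≟ 1#) elements-unique)
      (All.all-filter (λ ξ → (ξ ^ e) ≟ 1#) elements)

    T²∈roots : ∀ {x} → x ≉ 0# → Any (T x * T x ≈_) roots
    T²∈roots {x} x≉0 = ∈-filter⁺ ≈-setoid (λ ξ → (ξ ^ e) ≟ 1#)
      (λ ξ≈ξ′ root → trans (^-congˡ e (sym ξ≈ξ′)) root) (elements-complete (T x * T x)) (T²-root x≉0)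

    weight : Carrier → Carrier → ℕ
    weight ξ ξ′ = if does (ξ ≟ ξ′) then 5 else 8

    weight-≤8 : ∀ ξ ξ′ → weight ξ ξ′ ℕ.≤ 8
    weight-≤8 ξ ξ′ = if-≤ (does (ξ ≟ ξ′))
      where
      if-≤ : ∀ β → (if β then 5 else 8) ℕ.≤ 8
      if-≤ true  = ℕ.m≤m+n 5 3
      if-≤ false = ℕ.≤-refl

    weight-≈ : ∀ {ξ ξ′} → ξ ≈ ξ′ → weight ξ ξ′ ≡ 5
    weight-≈ {ξ} {ξ′} ξ≈ξ′ = ≡.cong (if_then 5 else 8) (dec-true (ξ ≟ ξ′) ξ≈ξ′)

    block-atMost-weight : ∀ ξ ξ′ → AtMost (weight ξ ξ′) (Block ξ ξ′)
    block-atMost-weight ξ ξ′ with toSum (ξ ≟ ξ′)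
    ... | inj₁ ξ≈ξ′ = atMost-≤ (ℕ.≤-reflexive (≡.sym (weight-≈ ξ≈ξ′))) (diagonalBlock-atMost-5 ξ≈ξ′)
    ... | inj₂ ξ≉ξ′ = atMost-≤ (ℕ.≤-reflexive (≡.sym (≡.cong (if_then 5 else 8) (dec-false (ξ ≟ ξ′) ξ≉ξ′)))) (block-atMost-8 ξ ξ′)

    -- The entry at ξ weighs 5 = 8 - 3 and the others at most 8. Adding 3 on the left avoids
    -- truncated subtraction in the induction.
    sum-weight : ∀ {ξ ks} → Any (ξ ≈_) ks → 3 ℕ.+ sum (map (weight ξ) ks) ℕ.≤ length ks ℕ.* 8
    sum-weight {ξ} {k ∷ ks} (here ξ≈k) rewrite weight-≈ ξ≈k =
      ℕ.+-monoʳ-≤ 8 (sum-map-≤ (weight ξ) (weight-≤8 ξ) ks)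
    sum-weight {ξ} {k ∷ ks} (there ξ∈ks) = ℕ.≤-trans
      (ℕ.≤-reflexive (≡.trans (≡.sym (ℕ.+-assoc 3 w s)) (≡.trans (≡.cong (ℕ._+ s) (ℕ.+-comm 3 w)) (ℕ.+-assoc w 3 s))))
      (ℕ.+-mono-≤ (weight-≤8 ξ k) (sum-weight ξ∈ks))
      where
      w = weight ξ k
      s = sum (map (weight ξ) ks)

    -- A nonempty row has ξ among the roots of unity, so the row contains its diagonal block, which
    -- saves 3.
    row-atMost : ∀ ξ → AtMost (N ℕ.* 8 ∸ 3) (λ x → Solution x × T (u x) * T (u x) ≈ ξ)
    row-atMost ξ = atMost-inhabited λ {x} (_ , u≈) →
      atMost-≤ (ℕ.∸-monoˡ-≤ 3 (sum-weight (Any.map (trans (sym u≈)) (T²∈roots (u-≉0 x)))))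
        (atMost-sum roots (λ y ξ′ → T (v y) * T (v y) ≈ ξ′) (weight ξ)
          (λ {y} _ → T²∈roots (v-≉0 y)) (block-atMost-weight ξ))

    -- There are at most e rows, and e (8e - 3) = 5e + 8e (e - 1).
    solution-atMost : AtMost (e ℕ.* (e ℕ.* 8 ∸ 3)) Solution
    solution-atMost = atMost-≤
      (ℕ.≤-trans (sum-map-≤ (λ _ → N ℕ.* 8 ∸ 3) (λ _ → ℕ.≤-refl) roots)
        (ℕ.*-mono-≤ N≤e (ℕ.∸-monoˡ-≤ 3 (ℕ.*-monoˡ-≤ 8 N≤e))))
      (atMost-sum roots (λ x ξ → T (u x) * T (u x) ≈ ξ) (λ _ → N ℕ.* 8 ∸ 3)
        (λ {x} _ → T²∈roots (u-≉0 x)) row-atMost)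

-- From fibre bounds to differential uniformity.

module _ {c ℓ q} (F : FiniteField c ℓ q) where
  open FiniteField F
  open Polynomials F
  open FiniteFieldProperties F
  open Cardinality ≈-setoid

  fibreSize-≤ : ∀ {n} g y → AtMost n (λ x → eval g x ≈ y) → fibreSize g y ℕ.≤ n
  fibreSize-≤ g y bound = bound
    (Unique.filter⁺ ≈-setoid (λ x → eval g x ≟ y) elements-unique)
    (All.all-filter (λ x → eval g x ≟ y) elements)

  differentialUniformity-≤ : ∀ {n} f → (∀ a → a ≉ 0# → ∀ y → fibreSize (Δ f a) y ℕ.≤ n) →
                             differentialUniformity f ℕ.≤ n
  differentialUniformity-≤ f bound = max≤v⁺ z≤n
    (All.cartesianProductWith⁺ ≈-setoid ≈-setoid (λ a y → fibreSize (Δ f a) y) nonzeroElements elements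
      (λ {a} {y} a∈ _ → bound a (nonzero a∈) y))
    where
    nonzero : ∀ {a} → Any (a ≈_) nonzeroElements → a ≉ 0#
    nonzero a∈ = proj₂ (∈-filter⁻ ≈-setoid (λ x → ¬? (x ≟ 0#)) (λ x≈y x≉0 → x≉0 ∘ trans x≈y) {xs = elements} a∈)

-- Rational arithmetic and conclusion.

open import Data.Rational.Unnormalised.Base using (_/_; _≤_; _*_; _-_; *≤*)

-- For d = 2e the right-hand side equals e (8e - 3) exactly.
e[8e-3]≤2d²-3d/2 : ∀ {n} e .{{_ : NonZero e}} → n ℕ.≤ e ℕ.* (e ℕ.* 8 ∸ 3) → let d = e ℕ.* 2 in
  (+ n) / 1 ≤ (+ 2 / 1) * (+ d / 1) * (+ d / 1) - (+ 3 / 2) * (+ d / 1)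
e[8e-3]≤2d²-3d/2 {n} (suc e) n≤ = *≤* (begin
  -- Cross-multiplied form, 2 being the denominator on the right. With `suc e` in place of e, the
  -- factor 8e - 3 computes to 5 + 8e.
  + n ℤ.* + 2                                        ≤⟨ ℤ.*-monoʳ-≤-nonNeg (+ 2) (ℤ.+≤+ n≤) ⟩
  + (suc e ℕ.* (5 ℕ.+ e ℕ.* 8)) ℤ.* + 2              ≡⟨ ≡.cong (ℤ._* + 2) (ℤ.pos-* (suc e) (5 ℕ.+ e ℕ.* 8)) ⟩
  + suc e ℤ.* (+ 5 ℤ.+ + (e ℕ.* 8)) ℤ.* + 2          ≡⟨ ≡.cong (λ i → + suc e ℤ.* (+ 5 ℤ.+ i) ℤ.* + 2) (ℤ.pos-* e 8) ⟩
  (+ 1 ℤ.+ E) ℤ.* (+ 5 ℤ.+ E ℤ.* + 8) ℤ.* + 2        ≡⟨ solve 1 (λ E →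
      (con (+ 1) :+ E) :* (con (+ 5) :+ E :* con (+ 8)) :* con (+ 2) :=
      ((con (+ 2) :* ((con (+ 1) :+ E) :* con (+ 2)) :* ((con (+ 1) :+ E) :* con (+ 2))) :* con (+ 2)
        :+ (:- (con (+ 3) :* ((con (+ 1) :+ E) :* con (+ 2)))) :* con (+ 1)) :* con (+ 1)) ≡.refl E ⟩
  numerator ((+ 1 ℤ.+ E) ℤ.* + 2)                    ≡⟨ ≡.cong numerator (ℤ.pos-* (suc e) 2) ⟨
  numerator (+ (suc e ℕ.* 2))                        ∎)
  where
  open ℤ.≤-Reasoning
  open +-*-Solver
  E = + e
  -- The unreduced numerator of 2D² - 3D/2, times the denominator 1 of the left-hand side.
  numerator : ℤ → ℤ
  numerator D = ((+ 2 ℤ.* D ℤ.* D) ℤ.* + 2 ℤ.+ (ℤ.- (+ 3 ℤ.* D)) ℤ.* + 1) ℤ.* + 1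

theorem1p4 : ∀ {c ℓ} (q : ℕ) → IsPrimePower q → Odd q →
    (F : FiniteField c ℓ q) → let open Polynomials F in
    (d : ℕ) .{{_ : NonZero d}} → Even d → d ∣ℕ (q ∸ 1) → Odd ((q ∸ 1) /ℕ d) →
    (h : Poly) →
    let T = X ^ₚ ((q ∸ 1) /ℕ d)
        f = X ^ₚ 2 *ₚ (h ∘ₚ T)
    in IsPermutationPolynomial f →
    (+ differentialUniformity f) / 1 ≤ (+ 2 / 1) * (+ d / 1) * (+ d / 1) - (+ 3 / 2) * (+ d / 1)
-- Evenness writes d as `suc e′ ℕ.* 2`; a zero quotient is excluded because d is nonzero.
theorem1p4 q _ q-odd F d (divides (suc e′) ≡.refl) d∣q-1 m-odd h (f-injective , _) =
  e[8e-3]≤2d²-3d/2 e (differentialUniformity-≤ F f fibres)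
  where
  open FiniteField F using (Carrier; _≈_; _≉_; 0#; sym; trans; *-cong; *-congˡ; *-identityʳ; commutativeSemiring) renaming (_*_ to _*ᶠ_)
  open Polynomials F
  open Evaluation F
  open FiniteFieldProperties F
  open ExpProperties commutativeSemiring using (_^_; ^-congˡ)
  e m : ℕ
  e = suc e′
  m = (q ∸ 1) /ℕ d
  f : Poly
  f = X ^ₚ 2 *ₚ (h ∘ₚ (X ^ₚ m))

  eval-f : ∀ x → eval f x ≈ (x *ᶠ x) *ᶠ eval h (x ^ m)
  eval-f x = trans (eval-*ₚ (X ^ₚ 2) (h ∘ₚ (X ^ₚ m)) x) (*-cong
    (trans (eval-^ₚ X 2 x) (trans (^-congˡ 2 (eval-X x)) (*-congˡ (*-identityʳ x))))
    (trans (eval-∘ₚ h (X ^ₚ m) x) (eval-cong h (trans (eval-^ₚ X m x) (^-congˡ m (eval-X x))))))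

  q-1≡ : q ∸ 1 ≡ m ℕ.* (2 ℕ.* e)
  q-1≡ = ≡.trans (≡.sym (m/n*n≡m d∣q-1)) (≡.cong (m ℕ.*_) (ℕ.*-comm e 2))

  fibres : ∀ a → a ≉ 0# → ∀ y → fibreSize (Δ f a) y ℕ.≤ e ℕ.* (e ℕ.* 8 ∸ 3)
  fibres a a≉0 y with even⊎odd m
  ... | inj₁ m-even   = contradiction m-even m-odd
  -- The odd exponent is brought to the form 2k + 1, and y takes the role of b.
  ... | inj₂ (k , m≡) = fibreSize-≤ F (Δ f a) y
    (Cardinality.atMost-⊆ (FiniteField.≈-setoid F) (trans (sym (eval-Δ f a _)))
      (Differential.solution-atMost F (odd⇒1+1≉0 q-odd) k e
        (≡.trans q-1≡ (≡.cong (ℕ._* (2 ℕ.* e)) m≡))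
        (eval h) (eval-cong h) (eval f)
        (λ x → trans (eval-f x) (*-congˡ (eval-cong h (FiniteField.reflexive F (≡.cong (x ^_) m≡)))))
        f-injective a a≉0 y))
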